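{- Let $X$ be a countable, second countable topological space. If $\mathcal{M}(X)\notin\boldsymbol{\Sigma}^0_2(\mathcal{P}(X))$, then $\mathcal{M}(X)$ is $\boldsymbol{\Pi}^0_3$-complete. In particular, $\mathcal{M}(X)$ is not $\boldsymbol{\Delta}^0_3$-sharp.
   Context: "Countable" means countably infinite (the paper writes "at most countable" when finite sets are allowed). For a topological space $X$, a subset $A\subseteq X$ is dense in an open set $U$ if $U\subseteq\overline{A}$, and codense in $U$ if $U\subseteq\overline{X\setminus A}$. A subset $A\subseteq X$ is monitorable if for every non-empty open set $U\subseteq X$ either $A$ is not dense in $U$ or $A$ is not codense in $U$. $\mathcal{M}(X)\subseteq\mathcal{P}(X)$ denotes the family of monitorable subsets of $X$. The powerset $\mathcal{P}(X)$ is identified with $2^X$ via characteristic functions and carries the product topology (with $2=\{0,1\}$ discrete); for countable $X$ it is homeomorphic to the Cantor space. $\boldsymbol{\Sigma}^0_\alpha,\boldsymbol{\Pi}^0_\alpha$ are the usual classes of the Borel hierarchy ($\boldsymbol{\Sigma}^0_1$ = open sets, $\boldsymbol{\Pi}^0_\alpha$ = complements of $\boldsymbol{\Sigma}^0_\alpha$ sets, $\boldsymbol{\Sigma}^0_\alpha$ = at most countable unions of sets in $\bigcup_{\beta<\alpha}\boldsymbol{\Pi}^0_\beta$ for $\alpha\geq 2$), and $\boldsymbol{\Delta}^0_\alpha=\boldsymbol{\Sigma}^0_\alpha\cap\boldsymbol{\Pi}^0_\alpha$. For a boldface pointclass $\boldsymbol{\Gamma}$ and a Polish space $Z$, a set $A\subseteq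 Z$ is $\boldsymbol{\Gamma}$-hard if for every zero-dimensional Polish space $Y$ and every $B\in\boldsymbol{\Gamma}(Y)$ there is a continuous $f:Y\to Z$ with $B=f^{ -1}(A)$; $A$ is $\boldsymbol{\Gamma}$-complete if $A\in\boldsymbol{\Gamma}(Z)$ and $A$ is $\boldsymbol{\Gamma}$-hard. For $\alpha\ge2$, $A\subseteq Z$ is $\boldsymbol{\Delta}^0_\alpha$-sharp if $A\in\boldsymbol{\Delta}^0_\alpha(Z)\setminus\bigcup_{\beta<\alpha}(\boldsymbol{\Sigma}^0_\beta(Z)\cup\boldsymbol{\Pi}^0_\beta(Z))$. -}

module Defs where

-- The mathematics is classical.  Results about these definitions are meant to
-- assume Axiom.ExcludedMiddle at every level, which for arbitrary types also
-- yields choice, and function extensionality, without which function spaces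
-- such as ℕ → Bool are not metric spaces for _≡_.

open import Algebra.Core using (Op₂)
open import Data.Bool.Base using (Bool; T)
open import Data.List.Base using (List; []; _++_)
open import Data.List.Relation.Unary.All using (All)
open import Data.List.Relation.Unary.All.Properties using (++⁻ˡ; ++⁻ʳ)
open import Data.Nat.Base as ℕ using (ℕ)
open import Data.Product using (Σ-syntax; ∃; ∃-syntax; ∃₂; _×_; _,_)
open import Data.Rational as ℚ using (ℚ; 0ℚ)
import Data.Rational.Properties as ℚ
open import Data.Sum.Base using (_⊎_)
open import Function.Base using (_∘_)
open import Function.Bundles using (_⤖_; _⇔_)
open import Function.Metric.Structures using (IsGeneralMetric)
open import Level using (Level; 0ℓ; _⊔_) renaming (suc to lsuc)
open import Relation.Binary.Core using (Rel)
open import Relation.Binary.PropositionalEquality.Core using (_≡_)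
open import Relation.Nullary.Negation.Core using (¬_)
open import Relation.Unary using
  (Pred; _∈_; _⊆_; _≐_; _∩_; _≬_; ∁; U; ⋃; _⊢_; Satisfiable)

-- Subsets are predicates, compared with _≐_, and the topology has to respect
-- that equality.  Families of opens are indexed by small types; assuming
-- excluded middle this gives the union of every family of opens, because one
-- member can be chosen for each point of the union.

record Space : Set₁ where
  field
    Carrier : Set
    IsOpen  : Pred (Pred Carrier 0ℓ) 0ℓ
    open-≐  : ∀ {V W} → V ≐ W → IsOpen V → IsOpen W
    open-U  : IsOpen U
    open-∩  : ∀ {V W} → IsOpen V → IsOpen W → IsOpen (V ∩ W)
    open-⋃  : ∀ {I : Set} (V : I → Pred Carrier 0ℓ) →
              (∀ i → IsOpen (V i)) → IsOpen (⋃ I V)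

open Space public using (Carrier; IsOpen)

Countable : Set → Set
Countable A = A ⤖ ℕ

AtMostCountable : {A : Set} → Pred A 0ℓ → Set
AtMostCountable {A} D =
  Σ[ f ∈ (A → ℕ) ] (∀ {x y} → x ∈ D → y ∈ D → f x ≡ f y → x ≡ y)

-- An at most countable base can be enumerated by ℕ, since repetitions are
-- allowed and ∅ may be added to any base.

SecondCountable : Space → Set₁
SecondCountable X =
  Σ[ B ∈ (ℕ → Pred (Carrier X) 0ℓ) ]
    (∀ n → IsOpen X (B n)) ×
    (∀ V → IsOpen X V → ∀ x → x ∈ V → ∃[ n ] x ∈ B n × B n ⊆ V)

Closure : (X : Space) → Pred (Carrier X) 0ℓ → Pred (Carrier X) (lsuc 0ℓ)
Closure X A x = ∀ V → IsOpen X V → x ∈ V → V ≬ A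

DenseIn CodenseIn : (X : Space) → Rel (Pred (Carrier X) 0ℓ) (lsuc 0ℓ)
DenseIn   X A V = V ⊆ Closure X A
CodenseIn X A V = V ⊆ Closure X (∁ A)

Monitorable : (X : Space) → Pred (Pred (Carrier X) 0ℓ) (lsuc 0ℓ)
Monitorable X A = ∀ V → IsOpen X V → Satisfiable V →
  ¬ DenseIn X A V ⊎ ¬ CodenseIn X A V

-- 2^A with the product topology: the basic open sets are the cylinders, which
-- prescribe the values at finitely many coordinates.

𝒫 : Set → Space
𝒫 A = record
  { Carrier = A → Bool
  ; IsOpen  = λ V → ∀ χ → χ ∈ V →
      Σ[ F ∈ List A ] (∀ ψ → All (λ a → ψ a ≡ χ a) F → ψ ∈ V)
  ; open-≐  = λ (V⊆W , W⊆V) oV χ χ∈W →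
      let F , h = oV χ (W⊆V χ∈W) in F , λ ψ e → V⊆W (h ψ e)
  ; open-U  = λ _ _ → [] , _
  ; open-∩  = λ oV oW χ (χ∈V , χ∈W) →
      let F , h = oV χ χ∈V
          G , k = oW χ χ∈W
      in F ++ G , λ ψ e → h ψ (++⁻ˡ F e) , k ψ (++⁻ʳ F e)
  ; open-⋃  = λ V oV χ (i , χ∈Vi) →
      let F , h = oV i χ χ∈Vi in F , λ ψ e → i , h ψ e
  }

𝓜 : (X : Space) → Pred (Carrier (𝒫 (Carrier X))) (lsuc 0ℓ)
𝓜 X χ = Monitorable X (T ∘ χ)

Continuous : (Y Z : Space) → Pred (Carrier Y → Carrier Z) (lsuc 0ℓ)
Continuous Y Z f = ∀ V → IsOpen Z V → IsOpen Y (f ⊢ V)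

-- A nonnegative real x is represented by { q ∈ ℚ | x < q }, an inhabited
-- upward closed set of positive rationals without least element.

record ℝ≥0 : Set₁ where
  field
    upper     : Pred ℚ 0ℓ
    inhabited : Satisfiable upper
    positive  : ∀ {q} → q ∈ upper → 0ℚ ℚ.< q
    upward    : ∀ {p q} → p ℚ.< q → p ∈ upper → q ∈ upper
    rounded   : ∀ {q} → q ∈ upper → ∃[ p ] p ℚ.< q × p ∈ upper

open ℝ≥0 public using (upper)

infix 4 _<ℚ_ _≈_ _≤_

_<ℚ_ : ℝ≥0 → ℚ → Set
x <ℚ q = q ∈ upper x

_≈_ _≤_ : Rel ℝ≥0 0ℓ
x ≈ y = upper x ≐ upper y
x ≤ y = upper y ⊆ upper x

0ℝ : ℝ≥0
0ℝ = record
  { upper     = 0ℚ ℚ.<_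
  ; inhabited = ℚ.1ℚ , ℚ.positive⁻¹ ℚ.1ℚ
  ; positive  = λ 0<q → 0<q
  ; upward    = λ p<q 0<p → ℚ.<-trans 0<p p<q
  ; rounded   = λ 0<q → let p , 0<p , p<q = ℚ.<-dense 0<q in p , p<q , 0<p
  }

_+_ : Op₂ ℝ≥0
x + y = record
  { upper     = λ q → ∃₂ λ r s → x <ℚ r × y <ℚ s × r ℚ.+ s ℚ.≤ q
  ; inhabited =
      let r , x<r = ℝ≥0.inhabited x
          s , y<s = ℝ≥0.inhabited y
      in r ℚ.+ s , r , s , x<r , y<s , ℚ.≤-refl
  ; positive  = λ (r , s , x<r , y<s , r+s≤q) →
      ℚ.<-≤-trans (ℚ.+-mono-< (ℝ≥0.positive x x<r) (ℝ≥0.positive y y<s)) r+s≤q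
  ; upward    = λ p<q (r , s , x<r , y<s , r+s≤p) →
      r , s , x<r , y<s , ℚ.≤-trans r+s≤p (ℚ.<⇒≤ p<q)
  ; rounded   = λ (r , s , x<r , y<s , r+s≤q) →
      let r′ , r′<r , x<r′ = ℝ≥0.rounded x x<r
      in r′ ℚ.+ s
       , ℚ.<-≤-trans (ℚ.+-monoˡ-< s r′<r) r+s≤q
       , r′ , s , x<r′ , y<s , ℚ.≤-refl
  }

IsMetric : {A : Set} → Pred (A → A → ℝ≥0) (lsuc 0ℓ)
IsMetric d = IsGeneralMetric _≡_ _≈_ _≤_ 0ℝ _+_ d

module _ {A : Set} (d : A → A → ℝ≥0) where

  MetricOpen : Pred (Pred A 0ℓ) 0ℓ
  MetricOpen V = ∀ x → x ∈ V →
    ∃[ ε ] 0ℚ ℚ.< ε × (∀ y → d x y <ℚ ε → y ∈ V)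

  Cauchy : Pred (ℕ → A) 0ℓ
  Cauchy s = ∀ ε → 0ℚ ℚ.< ε →
    ∃[ N ] (∀ m n → N ℕ.≤ m → N ℕ.≤ n → d (s m) (s n) <ℚ ε)

  ConvergesTo : (ℕ → A) → Pred A 0ℓ
  ConvergesTo s x = ∀ ε → 0ℚ ℚ.< ε →
    ∃[ N ] (∀ n → N ℕ.≤ n → d (s n) x <ℚ ε)

  Complete : Set
  Complete = ∀ s → Cauchy s → ∃[ x ] ConvergesTo s x

CompletelyMetrizable : Space → Set₁
CompletelyMetrizable Y =
  Σ[ d ∈ (Carrier Y → Carrier Y → ℝ≥0) ]
    IsMetric d × Complete d × (∀ V → IsOpen Y V ⇔ MetricOpen d V)

Separable : Space → Set₁
Separable Y = Σ[ D ∈ Pred (Carrier Y) 0ℓ ] AtMostCountable D × DenseIn Y D U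

Polish : Space → Set₁
Polish Y = Separable Y × CompletelyMetrizable Y

Clopen : (Y : Space) → Pred (Pred (Carrier Y) 0ℓ) 0ℓ
Clopen Y V = IsOpen Y V × IsOpen Y (∁ V)

ZeroDimensional : Space → Set₁
ZeroDimensional Y = ∀ V → IsOpen Y V → ∀ y → y ∈ V →
  Σ[ W ∈ Pred (Carrier Y) 0ℓ ] Clopen Y W × y ∈ W × W ⊆ V

-- The finite levels α ≥ 1 of the Borel hierarchy (level 0 is empty).  Sets may
-- live in any universe ℓ because 𝓜 X quantifies over all open sets.  Unions of
-- finitely many sets, or of none, are covered by repeating members or using ∅.

data Σ⁰ {ℓ : Level} (Z : Space) : ℕ → Pred (Carrier Z) ℓ → Set (lsuc (0ℓ ⊔ ℓ)) where
  isOpen  : ∀ {A} (V : Pred (Carrier Z) 0ℓ) → IsOpen Z V → A ≐ V → Σ⁰ Z 1 A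
  isUnion : ∀ {α A} → 2 ℕ.≤ α → (B : ℕ → Pred (Carrier Z) ℓ) →
            (∀ n → ∃[ β ] β ℕ.< α × Σ⁰ Z β (∁ (B n))) →
            A ≐ ⋃ ℕ B → Σ⁰ Z α A

Π⁰ Δ⁰ : {ℓ : Level} (Z : Space) → ℕ → Pred (Carrier Z) ℓ → Set (lsuc ℓ)
Π⁰ Z α A = Σ⁰ Z α (∁ A)
Δ⁰ Z α A = Σ⁰ Z α A × Π⁰ Z α A

Pointclass : (ℓ : Level) → Set (lsuc (lsuc ℓ))
Pointclass ℓ = (Z : Space) → Pred (Pred (Carrier Z) ℓ) (lsuc ℓ)

-- The target is meant to be Polish, but its metric plays no role here.

Hard : {ℓ : Level} → Pointclass ℓ → (Z : Space) → Pred (Carrier Z) ℓ → Set (lsuc ℓ)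
Hard Γ Z A = ∀ Y → Polish Y → ZeroDimensional Y → ∀ B → Γ Y B →
  Σ[ f ∈ (Carrier Y → Carrier Z) ] Continuous Y Z f × B ≐ f ⊢ A

CompleteFor : {ℓ : Level} → Pointclass ℓ → (Z : Space) → Pred (Carrier Z) ℓ → Set (lsuc ℓ)
CompleteFor Γ Z A = Γ Z A × Hard Γ Z A

Δ⁰-Sharp : {ℓ : Level} (Z : Space) → ℕ → Pred (Carrier Z) ℓ → Set (lsuc ℓ)
Δ⁰-Sharp Z α A = Δ⁰ Z α A × ¬ (∃[ β ] β ℕ.< α × (Σ⁰ Z β A ⊎ Π⁰ Z β A))

{-# OPTIONS --safe #-}
module Submission where

-- Call a point negligible if its singleton is nowhere dense, and a basic open set rich
-- if each of its non-empty basic subsets contains a negligible point.  A basic set that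
-- is not rich contains an atom, a non-empty open set without smaller ones, and on atoms
-- a monitorable set is constant, which is a closed condition.
--
-- If there is no infinite family of disjoint rich sets, then finitely many
-- hyperconnected rich sets meet every rich set.  On a hyperconnected set H,
-- monitorability only asks for one basic subset of H on which A is constant, which is
-- an F_σ condition, and so 𝓜 X is Σ⁰₂.
--
-- Given disjoint rich sets S₀, S₁, …, write the complement of a Π⁰₃ set as
-- ∃ n. ∀ m. ∃ k. y ∈ K n m k with K n m k clopen.  Choose distinct negligible points
-- p n m k in S n, and in the m-th basic set if that lies below S n, and send y to the
-- set of those p n m k for which k is the first stage at which the clauses i < m of
-- row n all have witnesses.  If row n holds, this set is dense and codense in S n;
-- otherwise it has finitely many points there, and these can be avoided.
-- Applying the same reduction to a diagonal Π⁰₃ set in Cantor space shows that 𝓜 X is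
-- not Σ⁰₃.

open import Defs
open import Axiom.ExcludedMiddle using (ExcludedMiddle)
open import Axiom.Extensionality.Propositional using (Extensionality)
import Algebra.Properties.AbelianGroup as AbelianGroup
open import Data.Bool.Base using (Bool; true; false; T; not)
import Data.Bool.Properties as Bool
open import Data.Integer.Base using (+_; -[1+_])
open import Data.List.Base using (List; []; _∷_; map; upTo)
open import Data.List.Membership.Propositional renaming (_∈_ to _∈ˡ_) using ()
open import Data.List.Membership.Propositional.Properties using (∈-map⁺; ∈-upTo⁺)
open import Data.List.Relation.Unary.All as All using (All; []; _∷_)
import Data.List.Relation.Unary.All.Properties as All
open import Data.List.Relation.Unary.Any using (here; there)
open import Data.Nat.Base as ℕ using (ℕ; zero; suc; _<_; _⊔_; z≤n; s≤s)
open import Data.Nat.Induction using (<-rec)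
import Data.Nat.Properties as ℕ
open import Data.Product using (Σ-syntax; ∃; ∃-syntax; _×_; _,_; proj₁; proj₂; map₂)
open import Data.Rational as ℚ using (ℚ; 0ℚ; ½; mkℚ)
import Data.Rational.Properties as ℚ
open import Data.Sum using (_⊎_; inj₁; inj₂)
open import Data.Unit.Base using (⊤)
open import Function using (_∘_; id; _⇔_; mk⇔; Equivalence)
open import Function.Metric.Structures using (IsGeneralMetric)
open import Level using (Level; 0ℓ; Lift; lift) renaming (suc to lsuc)
open import Relation.Binary.Definitions using (tri<; tri≈; tri>)
open import Relation.Binary.PropositionalEquality using
  (_≡_; _≢_; refl; sym; trans; cong; subst)
open import Relation.Nullary using (¬_; Dec; yes; no; contradiction)
open import Relation.Nullary.Decidable using (decidable-stable; ⌊_⌋; toWitness; fromWitness)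
open import Relation.Unary using
  (Pred; _∈_; _∉_; _⊆_; _≐_; _∩_; _≬_; ∁; ∅; ⋃; _⊢_; Satisfiable)

open Equivalence using (to; from)
open AbelianGroup ℚ.+-0-abelianGroup using (xyx⁻¹≈y)

private
  variable
    a ℓ : Level
    A : Set a

-- Enumerations

Enumeration : Set a → Set a
Enumeration A = Σ[ e ∈ (ℕ → A) ] (∀ x → ∃[ n ] e n ≡ x)

module _ (E : Enumeration A) where

  decode : ℕ → A
  decode = proj₁ E

  encode : A → ℕ
  encode = proj₁ ∘ proj₂ E

  decode-encode : ∀ x → decode (encode x) ≡ x
  decode-encode = proj₂ ∘ proj₂ E

diagonal : ℕ → ℕ × ℕ
diagonal zero = 0 , 0
diagonal (suc n) = next (diagonal n)
  where
  next : ℕ × ℕ → ℕ × ℕ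
  next (zero  , j) = suc j , 0
  next (suc i , j) = i , suc j

-- Induction along the walk: `(i , suc j)` follows `(suc i , j)` on the same antidiagonal, and
-- `(suc s , 0)` follows `(0 , s)`, the end of the previous one.
diagonal-surjective : ∀ s i j → i ℕ.+ j ≡ s → ∃[ n ] diagonal n ≡ (i , j)
diagonal-surjective zero    zero zero refl = 0 , refl
diagonal-surjective (suc s) i zero eq
  with refl ← trans (sym (ℕ.+-identityʳ i)) eq
  with n , e ← diagonal-surjective s 0 s refl = suc n , lemma e
  where
  lemma : diagonal n ≡ (0 , s) → diagonal (suc n) ≡ (suc s , 0)
  lemma e rewrite e = refl
diagonal-surjective s i (suc j) eq
  with n , e ← diagonal-surjective s (suc i) j (trans (sym (ℕ.+-suc i j)) eq) = suc n , lemma e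
  where
  lemma : diagonal n ≡ (suc i , j) → diagonal (suc n) ≡ (i , suc j)
  lemma e rewrite e = refl

pairs : Enumeration (ℕ × ℕ)
pairs = diagonal , λ (i , j) → diagonal-surjective (i ℕ.+ j) i j refl

enum-× : ∀ {b} {A : Set a} {B : Set b} → Enumeration A → Enumeration B → Enumeration (A × B)
enum-× {A = A} {B = B} E F = e , surj
  where
  e : ℕ → A × B
  e n = let i , j = decode pairs n in decode E i , decode F j
  surj : ∀ x → ∃[ n ] e n ≡ x
  surj (x , y) = n , eq
    where
    n = encode pairs (encode E x , encode F y)
    eq : e n ≡ (x , y)
    eq rewrite decode-encode pairs (encode E x , encode F y)
             | decode-encode E x | decode-encode F y = refl

enum-ℕ : Enumeration ℕ
enum-ℕ = id , λ n → n , refl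

enum-Bool : Enumeration Bool
enum-Bool = (λ { zero → false ; (suc _) → true }) , λ { false → 0 , refl ; true → 1 , refl }

-- The length is coded first, so that decoding the entries is a structural recursion on it.
enum-List : Enumeration A → Enumeration (List A)
enum-List {A = A} E = e , surj
  where
  ofLength : ℕ → ℕ → List A
  ofLength zero    _ = []
  ofLength (suc l) n = let i , j = decode pairs n in decode E i ∷ ofLength l j
  e : ℕ → List A
  e n = let l , c = decode pairs n in ofLength l c
  code : ∀ xs → ∃[ l ] ∃[ n ] ofLength l n ≡ xs
  code [] = 0 , 0 , refl
  code (x ∷ xs) with l , n , refl ← code xs = suc l , encode pairs (encode E x , n) , eq
    where
    eq : ofLength (suc l) (encode pairs (encode E x , n)) ≡ x ∷ ofLength l n
    eq rewrite decode-encode pairs (encode E x , n) | decode-encode E x = refl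
  surj : ∀ xs → ∃[ n ] e n ≡ xs
  surj xs with l , n , refl ← code xs = encode pairs (l , n) , eq
    where
    eq : e (encode pairs (l , n)) ≡ ofLength l n
    eq rewrite decode-encode pairs (l , n) = refl

abstract
  triples : Enumeration (ℕ × ℕ × ℕ)
  triples = enum-× enum-ℕ pairs

fraction : ℕ × ℕ → ℚ
fraction (m , n) = + m ℚ./ suc n

fraction-surjective : ∀ q → 0ℚ ℚ.< q → ∃[ x ] fraction x ≡ q
fraction-surjective q@(mkℚ (+ m) n _) _ = (m , n) , ℚ.↥p/↧p≡p q
fraction-surjective q@(mkℚ (-[1+ _ ]) _ _) 0<q = contradiction (ℚ.positive 0<q) λ ()

half : ∀ q → 0ℚ ℚ.< q → ∃[ r ] 0ℚ ℚ.< r × r ℚ.+ r ≡ q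
half q 0<q = r , 0<r , eq
  where
  r = ½ ℚ.* q
  0<r : 0ℚ ℚ.< r
  0<r = subst (ℚ._< r) (ℚ.*-zeroʳ ½) (ℚ.*-monoʳ-<-pos ½ 0<q)
  eq : r ℚ.+ r ≡ q
  eq = trans (sym (ℚ.*-distribʳ-+ q ½ ½)) (ℚ.*-identityˡ q)

common-bound : {R : A → ℕ → Set ℓ} (L : List A) → (∀ x → x ∈ˡ L → ∃ (R x)) →
  ∃[ N ] (∀ x → x ∈ˡ L → ∃[ m ] m < N × R x m)
common-bound [] h = 0 , λ _ ()
common-bound (y ∷ L) h
  with m , r ← h y (here refl)
  with N , g ← common-bound L (λ x → h x ∘ there) = suc m ⊔ N , λ where
    x (here refl) → m , ℕ.m≤m⊔n (suc m) N , r
    x (there x∈L) → let k , k<N , r = g x x∈L in k , ℕ.<-≤-trans k<N (ℕ.m≤n⊔m (suc m) N) , r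

-- Open and clopen sets

module _ (Y : Space) where
  open Space Y using (open-≐; open-U; open-∩; open-⋃)

  private
    variable
      V W : Pred (Carrier Y) 0ℓ

  open-local : (∀ y → V y → Σ[ W ∈ Pred (Carrier Y) 0ℓ ] IsOpen Y W × W y × W ⊆ V) → IsOpen Y V
  open-local {V} h = open-≐
    ((λ ((y , v) , w) → proj₂ (proj₂ (proj₂ (h y v))) w) ,
     (λ {y} v → (y , v) , proj₁ (proj₂ (proj₂ (h y v)))))
    (open-⋃ (λ ((y , v) : ∃ V) → proj₁ (h y v)) (λ (y , v) → proj₁ (proj₂ (h y v))))

  open-∅ : IsOpen Y ∅
  open-∅ = open-local λ _ ()

  open-guard : {Q : Set} → (Q → IsOpen Y V) → IsOpen Y (λ y → Q × V y)
  open-guard o = open-⋃ _ o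

  open-∀< : (P : ℕ → Pred (Carrier Y) 0ℓ) → (∀ i → IsOpen Y (P i)) →
    ∀ n → IsOpen Y (λ y → ∀ i → i < n → P i y)
  open-∀< P o zero = open-≐ ((λ _ _ ()) , _) open-U
  open-∀< P o (suc n) = open-≐ (to′ , λ h → h n ℕ.≤-refl , λ i i<n → h i (ℕ.m<n⇒m<1+n i<n))
    (open-∩ (o n) (open-∀< P o n))
    where
    to′ : P n ∩ (λ y → ∀ i → i < n → P i y) ⊆ (λ y → ∀ i → i < suc n → P i y)
    to′ (p , h) i i<1+n with ℕ.m<1+n⇒m<n∨m≡n i<1+n
    ... | inj₁ i<n  = h i i<n
    ... | inj₂ refl = p

-- Borel sets of finite level

-- The sets {y | ∃ n. ∀ m. ∃ k. y ∈ K n m k}, with K n m k clopen, are the Σ⁰₃ sets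
-- of zero-dimensional second countable spaces.
∃∀∃ : {A : Set} → (ℕ → ℕ → ℕ → Pred A 0ℓ) → Pred A 0ℓ
∃∀∃ K y = ∃[ n ] (∀ m → ∃[ k ] y ∈ K n m k)

HasClopenCovers : Space → Set₁
HasClopenCovers Y = ∀ V → IsOpen Y V →
  Σ[ K ∈ (ℕ → Pred (Carrier Y) 0ℓ) ] (∀ k → Clopen Y (K k)) × V ≐ ⋃ ℕ K

preimage-Σ⁰ : ∀ {ℓ} {Y Z : Space} {f} → Continuous Y Z f → ∀ {α} {A : Pred (Carrier Z) ℓ} →
  Σ⁰ Z α A → Σ⁰ Y α (f ⊢ A)
preimage-Σ⁰ c (isOpen V oV (s , t)) = isOpen _ (c V oV) (s , t)
preimage-Σ⁰ {f = f} c (isUnion 2≤α B h (s , t)) =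
  isUnion 2≤α (λ n → f ⊢ B n)
    (λ n → let β , β<α , σ = h n in β , β<α , preimage-Σ⁰ c σ) (s , t)

coordinate-open : ∀ {A : Set} (a : A) (Q : Pred Bool 0ℓ) → IsOpen (𝒫 A) (λ ψ → Q (ψ a))
coordinate-open a Q χ q = a ∷ [] , λ { ψ (e ∷ []) → subst Q (sym e) q }

-- Near `y`, finitely many coordinates of `f y` decide membership in `V`. Keeping their values is a
-- finite intersection of open conditions, since each value of a coordinate is taken on an open set.
continuous-into-𝒫 : ∀ (Y : Space) {A : Set} (f : Carrier Y → A → Bool) →
  (∀ a → Clopen Y (λ y → T (f y a))) → Continuous Y (𝒫 A) f
continuous-into-𝒫 Y {A} f cl V oV = open-local Y λ y v →
  let F , h = oV (f y) v
  in (λ y′ → All (λ a → f y′ a ≡ f y a) F) , agree-open F (f y)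
     , All.universal (λ _ → refl) F , h _
  where
  open Space Y using (open-≐; open-U; open-∩)

  value-open : ∀ a b → IsOpen Y (λ y → f y a ≡ b)
  value-open a true  = open-≐ (to Bool.T-≡ , from Bool.T-≡) (proj₁ (cl a))
  value-open a false = open-≐ (to Bool.T-not-≡ ∘ ¬T⇒T-not _ , λ e t → subst T e t) (proj₂ (cl a))
    where
    ¬T⇒T-not : ∀ b → ¬ T b → T (not b)
    ¬T⇒T-not true  h = contradiction _ h
    ¬T⇒T-not false h = _

  agree-open : ∀ F χ → IsOpen Y (λ y → All (λ a → f y a ≡ χ a) F)
  agree-open [] χ = open-≐ ((λ _ → []) , _) open-U
  agree-open (a ∷ F) χ = open-≐ ((λ (e , es) → e ∷ es) , λ { (e ∷ es) → e , es })
    (open-∩ (value-open a (χ a)) (agree-open F χ))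

-- Classical reasoning and sequential choice

module Classical (em : ∀ ℓ → ExcludedMiddle ℓ) where

  by-contradiction : {P : Set ℓ} → ¬ ¬ P → P
  by-contradiction = decidable-stable (em _)

  ¬∀⇒∃¬ : ∀ {p} {P : A → Set p} → ¬ (∀ x → P x) → ∃[ x ] ¬ P x
  ¬∀⇒∃¬ h = by-contradiction λ g → h λ x → by-contradiction λ np → g (x , np)

  abstract
    least : {P : ℕ → Set ℓ} → ∃ P → ∃[ n ] P n × (∀ m → m < n → ¬ P m)
    least {P = P} (n , p) = <-rec (λ n → P n → ∃[ n ] P n × (∀ m → m < n → ¬ P m)) step n p
      where
      step : ∀ n → (∀ {m} → m < n → P m → ∃[ n ] P n × (∀ m → m < n → ¬ P m)) →
        P n → ∃[ n ] P n × (∀ m → m < n → ¬ P m)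
      step n ih p with em _ {∃[ m ] m < n × P m}
      ... | yes (m , m<n , q) = ih m<n q
      ... | no none = n , p , λ m m<n q → none (m , m<n , q)

  abstract
    -- Dependent choice: `Good` is the invariant, `P j` the demand of stage `j`, and `R` relates
    -- each new term to all earlier ones. It yields both the disjoint sets of `finite-core` and the
    -- distinct points of the reduction.
    greedy : ∀ {p r} {A : Set} {Good : A → Set p} {P : ℕ → A → Set r} {R : A → A → Set r} →
      (∀ j L → All Good L → ∃[ x ] Good x × P j x × All (R x) L) →
      Σ[ s ∈ (ℕ → A) ] (∀ j → Good (s j)) × (∀ j → P j (s j)) × (∀ i j → i < j → R (s j) (s i))
    greedy {A = A} {Good} {P} {R} pick =
      s , (λ j → proj₁ (proj₂ (picked j))) , (λ j → proj₁ (proj₂ (proj₂ (picked j)))) ,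
      λ i j i<j → All.lookup (proj₂ (proj₂ (proj₂ (picked j)))) (earlier j i<j)
      where
      before : ℕ → Σ[ L ∈ List A ] All Good L
      picked : ∀ j → ∃[ x ] Good x × P j x × All (R x) (proj₁ (before j))
      before zero = [] , []
      before (suc j) = proj₁ (picked j) ∷ proj₁ (before j) , proj₁ (proj₂ (picked j)) ∷ proj₂ (before j)
      picked j = pick j (proj₁ (before j)) (proj₂ (before j))
      s : ℕ → A
      s j = proj₁ (picked j)
      earlier : ∀ {i} j → i < j → s i ∈ˡ proj₁ (before j)
      earlier (suc j) i<1+j with ℕ.m<1+n⇒m<n∨m≡n i<1+j
      ... | inj₁ i<j  = there (earlier j i<j)
      ... | inj₂ refl = here refl

  -- Operations on clopen and closed sets

  module _ (Y : Space) where
    open Space Y using (open-≐; open-U; open-∩; open-⋃)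

    private
      variable
        V W : Pred (Carrier Y) 0ℓ

    clopen-≐ : V ≐ W → Clopen Y V → Clopen Y W
    clopen-≐ e@(p , q) (o , c) = open-≐ e o , open-≐ ((λ h w → h (q w)) , λ h v → h (p v)) c

    closed-guard : {Q : Set} → (Q → IsOpen Y (∁ V)) → IsOpen Y (∁ λ y → Q × V y)
    closed-guard {Q = Q} c with em _ {Q}
    ... | yes q = open-≐ ((λ nv (_ , v) → nv v) , λ h v → h (q , v)) (c q)
    ... | no nq = open-≐ ((λ _ (q , _) → nq q) , _) open-U

    clopen-guard : {Q : Set} → Clopen Y V → Clopen Y (λ y → Q × V y)
    clopen-guard (o , c) = open-guard Y (λ _ → o) , closed-guard λ _ → c

    clopen-∅ : Clopen Y ∅
    clopen-∅ = open-∅ Y , open-≐ ((λ _ ()) , _) open-U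

    clopen-∁ : Clopen Y V → Clopen Y (∁ V)
    clopen-∁ (o , c) = c , open-≐ ((λ v h → h v) , by-contradiction) o

    clopen-∀< : (P : ℕ → Pred (Carrier Y) 0ℓ) → (∀ i → Clopen Y (P i)) →
      ∀ n → Clopen Y (λ y → ∀ i → i < n → P i y)
    clopen-∀< P c n = open-∀< Y P (proj₁ ∘ c) n ,
      open-≐ ((λ (i , i<n , np) h → np (h i i<n)) , λ h →
        by-contradiction λ g → h λ i i<n → by-contradiction λ np → g (i , i<n , np))
      (open-⋃ _ λ i → open-guard Y λ _ → proj₂ (c i))

    closed-∃< : (P : ℕ → Pred (Carrier Y) 0ℓ) → (∀ i → IsOpen Y (∁ (P i))) →
      ∀ n → IsOpen Y (∁ λ y → ∃[ i ] i < n × P i y)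
    closed-∃< P c n = open-≐
      ((λ h (i , i<n , p) → h i i<n p) , λ h i i<n p → h (i , i<n , p)) (open-∀< Y (∁ ∘ P) c n)

    clopen-∃< : (P : ℕ → Pred (Carrier Y) 0ℓ) → (∀ i → Clopen Y (P i)) →
      ∀ n → Clopen Y (λ y → ∃[ i ] i < n × P i y)
    clopen-∃< P c n = open-⋃ _ (λ i → open-guard Y λ _ → proj₁ (c i)) , closed-∃< P (proj₂ ∘ c) n

    clopen-∩ : Clopen Y V → Clopen Y W → Clopen Y (V ∩ W)
    clopen-∩ {V} {W} (o , c) (o′ , c′) = open-∩ o o′ , open-local Y neigh
      where
      neigh : ∀ y → ¬ (V ∩ W) y → Σ[ C ∈ Pred (Carrier Y) 0ℓ ] IsOpen Y C × C y × C ⊆ ∁ (V ∩ W)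
      neigh y h with em _ {V y}
      ... | yes v = ∁ W , c′ , (λ w → h (v , w)) , λ nw (_ , w) → nw w
      ... | no nv = ∁ V , c , nv , λ nv (v , _) → nv v

    closed-∀ : {I : Set} (P : I → Pred (Carrier Y) 0ℓ) → (∀ i → IsOpen Y (∁ (P i))) →
      IsOpen Y (∁ λ y → ∀ i → P i y)
    closed-∀ P c = open-≐ ((λ (i , np) h → np (h i)) , ¬∀⇒∃¬) (open-⋃ _ c)

  -- Normal forms of Σ⁰₂ and Σ⁰₃ sets

  Σ⁰₁⁻ : ∀ {Y β} {A : Pred (Carrier Y) ℓ} → β < 2 → Σ⁰ Y β A →
    Σ[ V ∈ Pred (Carrier Y) 0ℓ ] IsOpen Y V × A ≐ V
  Σ⁰₁⁻ _ (isOpen V oV e) = V , oV , e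
  Σ⁰₁⁻ β<2 (isUnion 2≤β _ _ _) = contradiction β<2 (ℕ.≤⇒≯ 2≤β)

  module _ (Y : Space) (covers : HasClopenCovers Y) where

    Σ⁰₂-normal-form : ∀ {β} {A : Pred (Carrier Y) ℓ} → β < 3 → Σ⁰ Y β A →
      Σ[ K ∈ (ℕ → ℕ → Pred (Carrier Y) 0ℓ) ] (∀ m k → Clopen Y (K m k)) ×
        (∀ y → y ∈ A ⇔ (∃[ m ] (∀ k → y ∉ K m k)))
    Σ⁰₂-normal-form _ (isOpen V oV (s , t)) =
      let K , cl , (p , q) = covers V oV
      -- A clopen `K m` is itself a closed piece: it consists of the points outside the constant
      -- family `∁ (K m)`.
      in (λ m _ → ∁ (K m)) , (λ m _ → clopen-∁ Y (cl m)) , λ y → mk⇔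
        (λ v → let m , x = p (s v) in m , λ _ h → h x)
        (λ (m , h) → t (q (m , by-contradiction (h 0))))
    Σ⁰₂-normal-form β<3 (isUnion _ E h (s , t)) =
      (λ m → proj₁ (cov m)) , (λ m → proj₁ (proj₂ (cov m))) , λ y → mk⇔
        (λ v → let m , x = s v
                   p , q = proj₂ (proj₂ (cov m))
               in m , λ k z → proj₂ (proj₂ (proj₂ (∁E m))) (q (k , z)) x)
        (λ (m , g) → t (m , by-contradiction λ ne →
          let p , q = proj₂ (proj₂ (cov m))
              k , z = p (proj₁ (proj₂ (proj₂ (∁E m))) ne)
          in g k z))
      where
      ∁E : ∀ m → Σ[ V ∈ Pred (Carrier Y) 0ℓ ] IsOpen Y V × ∁ (E m) ≐ V
      ∁E m = let β , β<α , σ = h m in Σ⁰₁⁻ (ℕ.<-≤-trans β<α (ℕ.s≤s⁻¹ β<3)) σ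
      cov : ∀ m → Σ[ K ∈ (ℕ → Pred (Carrier Y) 0ℓ) ]
        (∀ k → Clopen Y (K k)) × proj₁ (∁E m) ≐ ⋃ ℕ K
      cov m = let V , oV , _ = ∁E m in covers V oV

    -- The Σ⁰₂ normal form of each `∁ (B n)` is negated, which turns `∃ m ∀ k` with `∉` into
    -- `∀ m ∃ k` with `∈`.
    Σ⁰₃-normal-form : ∀ {A : Pred (Carrier Y) ℓ} → Σ⁰ Y 3 A →
      Σ[ K ∈ (ℕ → ℕ → ℕ → Pred (Carrier Y) 0ℓ) ] (∀ n m k → Clopen Y (K n m k)) ×
        (∀ y → y ∈ A ⇔ y ∈ ∃∀∃ K)
    Σ⁰₃-normal-form {A = A} (isUnion _ B h (s , t)) =
      K , (λ n → proj₁ (proj₂ (nf n))) , λ y → mk⇔ (fwd y) (bwd y)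
      where
      nf : ∀ n → Σ[ K ∈ (ℕ → ℕ → Pred (Carrier Y) 0ℓ) ] (∀ m k → Clopen Y (K m k)) ×
        (∀ y → y ∈ ∁ (B n) ⇔ (∃[ m ] (∀ k → y ∉ K m k)))
      nf n = let β , β<3 , σ = h n in Σ⁰₂-normal-form β<3 σ
      K = λ n → proj₁ (nf n)
      fwd : ∀ y → y ∈ A → y ∈ ∃∀∃ K
      fwd y v = let n , x = s v in n , λ m → by-contradiction λ g →
        from (proj₂ (proj₂ (nf n)) y) (m , λ k z → g (k , z)) x
      bwd : ∀ y → y ∈ ∃∀∃ K → y ∈ A
      bwd y (n , g) = t (n , by-contradiction λ nb →
        let m , x = to (proj₂ (proj₂ (nf n)) y) nb
            k , z = g m
        in x k z)

  -- Countable clopen covers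

  Cylinder : List (ℕ × Bool) → Pred (ℕ → Bool) 0ℓ
  Cylinder σ χ = All (λ (i , b) → χ i ≡ b) σ

  abstract
    cylinders : Enumeration (List (ℕ × Bool))
    cylinders = enum-List (enum-× enum-ℕ enum-Bool)

  Cylinder-clopen : ∀ σ → Clopen (𝒫 ℕ) (Cylinder σ)
  Cylinder-clopen [] = clopen-≐ (𝒫 ℕ) ((λ _ → []) , λ _ ()) (clopen-∁ (𝒫 ℕ) (clopen-∅ (𝒫 ℕ)))
  Cylinder-clopen ((i , b) ∷ σ) = clopen-≐ (𝒫 ℕ)
    ((λ (e , es) → e ∷ es) , λ { (e ∷ es) → e , es })
    (clopen-∩ (𝒫 ℕ) (coordinate-open i (_≡ b) , coordinate-open i (_≢ b)) (Cylinder-clopen σ))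

  -- All cylinders are listed, and the guard `⊆ V` empties those that leave `V`. Thus the index of a
  -- member is the code of its cylinder, on which the diagonal argument relies.
  cantor-covers : HasClopenCovers (𝒫 ℕ)
  cantor-covers V oV =
    (λ k χ → Cylinder (decode cylinders k) ⊆ V × Cylinder (decode cylinders k) χ) ,
    (λ k → clopen-guard (𝒫 ℕ) (Cylinder-clopen (decode cylinders k))) ,
    covered , λ (k , C⊆V , c) → C⊆V c
    where
    covered : ∀ {χ} → χ ∈ V →
      ∃[ k ] Cylinder (decode cylinders k) ⊆ V × Cylinder (decode cylinders k) χ
    covered {χ} v =
      let F , h = oV χ v
          σ = map (λ i → i , χ i) F
      in encode cylinders σ , subst
           (λ τ → Cylinder τ ⊆ V × Cylinder τ χ) (sym (decode-encode cylinders σ))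
           ((λ e → h _ (All.map⁻ e)) , All.map⁺ (All.universal (λ _ → refl) F))

  module _ {A : Set} {d : A → A → ℝ≥0} (metric : IsMetric d) where
    open IsGeneralMetric metric using (triangle; ≈⇒0) renaming (sym to d-sym)

    ball-triangle : ∀ {x y z r s q} → d x y <ℚ r → d y z <ℚ s → r ℚ.+ s ℚ.≤ q → d x z <ℚ q
    ball-triangle xy yz le = triangle _ _ _ (_ , _ , xy , yz , le)

    dist-sym : ∀ {x y q} → d x y <ℚ q → d y x <ℚ q
    dist-sym = proj₁ (d-sym _ _)

    self-dist : ∀ x {q} → 0ℚ ℚ.< q → d x x <ℚ q
    self-dist x = proj₂ (≈⇒0 refl)

    ball-open : ∀ x q → MetricOpen d (λ y → d x y <ℚ q)
    ball-open x q y xy =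
      let p , p<q , xy′ = ℝ≥0.rounded (d x y) xy
      in q ℚ.- p , subst (ℚ._< q ℚ.- p) (ℚ.+-inverseʳ p) (ℚ.+-monoˡ-< (ℚ.- p) p<q) ,
         λ z yz → ball-triangle xy′ yz (ℚ.≤-reflexive
           (trans (sym (ℚ.+-assoc p q (ℚ.- p))) (xyx⁻¹≈y p q)))

  -- Lindelöf: for each ball with centre in the dense set and rational radius, take
  -- one clopen set between the ball and V, if there is one.
  polish-covers : ∀ Y → Polish Y → ZeroDimensional Y → HasClopenCovers Y
  polish-covers Y ((D , (index , index-injective) , dense) , d , metric , _ , topology) zd V oV =
    (λ k → proj₁ (member k)) , (λ k → proj₁ (proj₂ (member k))) ,
    (λ {y} v → covered y v) , λ (k , w) → proj₁ (proj₂ (proj₂ (member k))) w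
    where
    -- The centre is named by its code `i`, so that the cover is indexed by countably many pairs
    -- `(i , q)`.
    Around : ℕ → ℚ → Pred (Carrier Y) 0ℓ → Set
    Around i q W = ∃[ c ] D c × index c ≡ i × (∀ z → d c z <ℚ q → W z)

    Between : ℕ → ℚ → Set₁
    Between i q = Σ[ W ∈ Pred (Carrier Y) 0ℓ ] Clopen Y W × W ⊆ V × Around i q W

    Pick : ℕ → ℚ → Set₁
    Pick i q = Σ[ W ∈ Pred (Carrier Y) 0ℓ ] Clopen Y W × W ⊆ V × (Between i q → Around i q W)

    pick : ∀ i q → Dec (Between i q) → Pick i q
    pick i q (yes (W , cl , W⊆V , a)) = W , cl , W⊆V , λ _ → a
    pick i q (no none) = ∅ , clopen-∅ Y , (λ ()) , λ b → contradiction b none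

    chosen : ∀ i q → Pick i q
    chosen i q = pick i q (em _)

    member : ∀ k → Pick (proj₁ (decode triples k)) (fraction (proj₂ (decode triples k)))
    member k = chosen _ _

    covered : ∀ y → y ∈ V → ∃[ k ] y ∈ proj₁ (member k)
    covered y v =
      -- The ball of radius `ε`, twice `δ`, about `y` fits into a clopen `W`. For `c` in the dense
      -- set within `δ` of `y`, the `δ`-ball about `c` contains `y` and stays in `W`.
      let W , cl , y∈W , W⊆V = zd V oV y v
          ε , 0<ε , h = to (topology W) (proj₁ cl) y y∈W
          δ , 0<δ , δ+δ≡ε = half ε 0<ε
          c , yc , c∈D = dense _ (λ z → d y z <ℚ δ)
            (from (topology _) (ball-open metric y δ)) (self-dist metric y 0<δ)
          x , x≡δ = fraction-surjective δ 0<δ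
          between : Between (index c) δ
          between = W , cl , (λ {x} → W⊆V {x}) , c , c∈D , refl ,
            λ z cz → h z (ball-triangle metric yc cz (ℚ.≤-reflexive δ+δ≡ε))
          -- The set chosen for this code may differ from `W`, but it contains the `δ`-ball about a
          -- centre with the same code as `c`, which is `c` by injectivity.
          c′ , c′∈D , same , ball⊆ = proj₂ (proj₂ (proj₂ (chosen (index c) δ))) between
          y∈ = ball⊆ y (subst (λ c → d c y <ℚ δ) (sym (index-injective c′∈D c∈D same))
                              (dist-sym metric yc))
      in encode triples (index c , x) ,
         subst (λ (i , z) → y ∈ proj₁ (chosen i (fraction z)))
           (sym (decode-encode triples (index c , x)))
           (subst (λ q → y ∈ proj₁ (chosen (index c) q)) (sym x≡δ) y∈)

  -- Monitorability over a countable base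

  module Monitorability (X : Space) (secondCountable : SecondCountable X) where
    open Space X using (open-U; open-∩)

    private
      B : ℕ → Pred (Carrier X) 0ℓ
      B = proj₁ secondCountable

      B-open : ∀ n → IsOpen X (B n)
      B-open = proj₁ (proj₂ secondCountable)

      variable
        i j k m n : ℕ

    infix 4 _⊑_

    -- Non-emptiness is built in, so that any set reached by going below `n` can be refined further.
    _⊑_ : ℕ → ℕ → Set
    m ⊑ n = Satisfiable (B m) × B m ⊆ B n

    Meets : ℕ → ℕ → Set
    Meets m n = B m ≬ B n

    ⊑-refl : Satisfiable (B n) → n ⊑ n
    ⊑-refl ne = ne , id

    ⊑-trans : k ⊑ m → m ⊑ n → k ⊑ n
    ⊑-trans (ne , s) (_ , t) = ne , t ∘ s

    meets-sym : Meets m n → Meets n m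
    meets-sym (x , xm , xn) = x , xn , xm

    meets-mono : B m ⊆ B i → B n ⊆ B j → Meets m n → Meets i j
    meets-mono s t (x , xm , xn) = x , s xm , t xn

    refine : ∀ {V} → IsOpen X V → ∀ {x} → x ∈ V → ∃[ m ] x ∈ B m × B m ⊆ V
    refine oV x∈V = proj₂ (proj₂ secondCountable) _ oV _ x∈V

    meet : Meets i j → ∃[ k ] k ⊑ i × k ⊑ j
    meet {i} {j} (x , xi , xj) =
      let k , xk , s = refine (open-∩ (B-open i) (B-open j)) (xi , xj)
      in k , ((x , xk) , proj₁ ∘ s) , ((x , xk) , proj₂ ∘ s)

    Mixed : Pred (Carrier X) 0ℓ → Pred (Carrier X) 0ℓ → Set
    Mixed V A = V ≬ A × V ≬ ∁ A

    mixed-mono : ∀ {V W A} → V ⊆ W → Mixed V A → Mixed W A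
    mixed-mono V⊆W ((x , v , a) , (y , w , b)) = (x , V⊆W v , a) , (y , V⊆W w , b)

    -- Monitorability in terms of the base alone, which brings it from `Set₁` down to `Set`;
    -- `monitorable⇒pure` and `pure⇒monitorable` give the equivalence.
    LocallyPure : Pred (Carrier X) 0ℓ → Set
    LocallyPure A = ∀ n → Satisfiable (B n) → ∃[ m ] m ⊑ n × ¬ Mixed (B m) A

    -- Some point of `B n` has an open neighbourhood missing `A`; a basic set around that point
    -- inside both does the job.
    ¬dense⇒avoids : ∀ {A} → ¬ DenseIn X A (B n) → ∃[ m ] m ⊑ n × ¬ B m ≬ A
    ¬dense⇒avoids {n} {A} ¬dense =
      let x , h = ¬∀⇒∃¬ {P = λ x → x ∈ B n → Closure X A x} (λ g → ¬dense λ {x} → g x)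
          xn , h′ = ¬∀⇒∃¬ h
          V , h″ = ¬∀⇒∃¬ h′
          oV , h‴ = ¬∀⇒∃¬ h″
          xV , ¬meets = ¬∀⇒∃¬ h‴
          m , xm , s = refine (open-∩ oV (B-open n)) (xV , xn)
      in m , ((x , xm) , proj₂ ∘ s) , λ (y , ym , ya) → ¬meets (y , proj₁ (s ym) , ya)

    monitorable⇒pure : ∀ {A} → Monitorable X A → LocallyPure A
    monitorable⇒pure {A} mon n ne with mon (B n) (B-open n) ne
    ... | inj₁ ¬dense   = map₂ (map₂ λ h → h ∘ proj₁) (¬dense⇒avoids ¬dense)
    ... | inj₂ ¬codense = map₂ (map₂ λ h → h ∘ proj₂) (¬dense⇒avoids ¬codense)

    -- On an unmixed basic subset, `A` either has no point and is not dense there, or has a point,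
    -- and then codensity would make the subset mixed.
    pure⇒monitorable : ∀ {A} → LocallyPure A → Monitorable X A
    pure⇒monitorable {A} pure V oV (x , x∈V)
      with n , xn , Bn⊆V ← refine oV x∈V
      with m , ((y , ym) , Bm⊆Bn) , ¬mixed ← pure n (x , xn)
      with em _ {B m ≬ A}
    ... | no none = inj₁ λ dense → none (dense (Bn⊆V (Bm⊆Bn ym)) (B m) (B-open m) ym)
    ... | yes some = inj₂ λ codense →
      ¬mixed (some , codense (Bn⊆V (Bm⊆Bn ym)) (B m) (B-open m) ym)

    -- Negligible points, rich sets and atoms

    Negligible : Pred (Carrier X) 0ℓ
    Negligible p = ∀ n → Satisfiable (B n) → ∃[ m ] m ⊑ n × p ∉ B m

    Rich : Pred ℕ 0ℓ
    Rich n = ∀ m → m ⊑ n → B m ≬ Negligible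

    Atomic : Pred ℕ 0ℓ
    Atomic n = Satisfiable (B n) × (∀ m → m ⊑ n → B n ⊆ B m)

    rich-mono : m ⊑ n → Rich n → Rich m
    rich-mono m⊑n rich k k⊑m = rich k (⊑-trans k⊑m m⊑n)

    ¬negligible⇒generic : ∀ {p} → ¬ Negligible p →
      ∃[ n ] Satisfiable (B n) × (∀ m → m ⊑ n → p ∈ B m)
    ¬negligible⇒generic h =
      let n , g = ¬∀⇒∃¬ h
          ne , g′ = ¬∀⇒∃¬ g
      in n , ne , λ m m⊑n → by-contradiction λ np → g′ (m , m⊑n , np)

    -- Take `m` below `n` without negligible points. A point `p` of `B m` lies in every non-empty
    -- basic subset of some `B i`, and `k` is taken below both `i` and `m`. Any `q` in `B k` has
    -- such a set `B i′` too. For `l` below `k`, the point `p` links `B l` to a part of `B i′`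
    -- inside `B k`, and their common subset contains `q`; so `B k` is contained in `B l`.
    ¬rich⇒atom : ¬ Rich n → ∃[ k ] k ⊑ n × Atomic k
    ¬rich⇒atom ¬rich
      with m , h ← ¬∀⇒∃¬ ¬rich
      with m⊑n , none ← ¬∀⇒∃¬ h
      with p , pm ← proj₁ m⊑n
      with i , ne , p∈ ← ¬negligible⇒generic (λ ng → none (p , pm , ng))
      with k , k⊑i , k⊑m ← meet (p , p∈ i (⊑-refl ne) , pm)
      = k , ⊑-trans k⊑m m⊑n , proj₁ k⊑m , minimal
      where
      minimal : ∀ l → l ⊑ k → B k ⊆ B l
      minimal l l⊑k {q} qk =
        let i′ , ne′ , q∈ = ¬negligible⇒generic (λ ng → none (q , proj₂ k⊑m qk , ng))
            k′ , k′⊑i′ , k′⊑k = meet (q , q∈ i′ (⊑-refl ne′) , qk)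
            l′ , l′⊑k′ , l′⊑l = meet
              (p , p∈ k′ (⊑-trans k′⊑k k⊑i) , p∈ l (⊑-trans l⊑k k⊑i))
        in proj₂ l′⊑l (q∈ l′ (⊑-trans l′⊑k′ k′⊑i′))

    -- Finite unions of nowhere dense sets are nowhere dense: the points are escaped one after the
    -- other.
    avoid : ∀ L → All Negligible L → ∀ n → Satisfiable (B n) → ∃[ m ] m ⊑ n × All (_∉ B m) L
    avoid [] [] n ne = n , ⊑-refl ne , []
    avoid (p ∷ L) (np ∷ nL) n ne =
      let m , m⊑n , p∉ = np n ne
          k , k⊑m , L∉ = avoid L nL m (proj₁ m⊑n)
      in k , ⊑-trans k⊑m m⊑n , p∉ ∘ proj₂ k⊑m ∷ L∉

    -- Antichains and hyperconnected sets

    record Antichain : Set where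
      field
        member    : ℕ → ℕ
        -- An empty basic set is vacuously rich, so this is demanded separately.
        inhabited : ∀ i → Satisfiable (B (member i))
        rich      : ∀ i → Rich (member i)
        disjoint  : ∀ i j → i < j → ¬ Meets (member j) (member i)

    Hyperconnected : Pred ℕ 0ℓ
    Hyperconnected n = ∀ i j → i ⊑ n → j ⊑ n → Meets i j

    -- Otherwise every set below `n` contains two disjoint ones. Splitting one of them again and
    -- setting the other aside, forever, leaves an antichain of sets put aside.
    hyperconnected-below : ¬ Antichain → Satisfiable (B n) → Rich n →
      ∃[ h ] h ⊑ n × Hyperconnected h
    hyperconnected-below {n} none ne rich = by-contradiction λ ¬hyper → none (splitting ¬hyper)
      where
      module _ (¬hyper : ¬ (∃[ h ] h ⊑ n × Hyperconnected h)) where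
        split : ∀ h → h ⊑ n → ∃[ i ] ∃[ j ] i ⊑ h × j ⊑ h × ¬ Meets i j
        split h h⊑n = by-contradiction λ g → ¬hyper (h , h⊑n , λ i j i⊑h j⊑h →
          by-contradiction λ apart → g (i , j , i⊑h , j⊑h , apart))

        state : ℕ → ∃[ h ] h ⊑ n
        state zero = n , ⊑-refl ne
        state (suc i) =
          let h , h⊑n = state i
              k , _ , k⊑h , _ = split h h⊑n
          in k , ⊑-trans k⊑h h⊑n

        side : ∀ i → ∃[ j ] j ⊑ proj₁ (state i) × ¬ Meets (proj₁ (state (suc i))) j
        side i =
          let _ , j , _ , j⊑h , apart = split (proj₁ (state i)) (proj₂ (state i))
          in j , j⊑h , apart

        descends : ∀ i → proj₁ (state (suc i)) ⊑ proj₁ (state i)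
        descends i = proj₁ (proj₂ (proj₂ (split (proj₁ (state i)) (proj₂ (state i)))))

        state-mono : ∀ j → i ℕ.≤ j → proj₁ (state j) ⊑ proj₁ (state i)
        state-mono {i} j i≤j with ℕ.m≤n⇒m<n∨m≡n i≤j
        state-mono j _ | inj₂ refl = ⊑-refl (proj₁ (proj₂ (state j)))
        state-mono (suc j) _ | inj₁ i<1+j =
          ⊑-trans (descends j) (state-mono j (ℕ.s≤s⁻¹ i<1+j))

        splitting : Antichain
        splitting = record
          { member    = λ i → proj₁ (side i)
          ; inhabited = λ i → proj₁ (proj₁ (proj₂ (side i)))
          ; rich      = λ i → rich-mono (⊑-trans (proj₁ (proj₂ (side i))) (proj₂ (state i))) rich
          -- The later `side j` lies inside `state (suc i)`, which misses `side i`.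
          ; disjoint  = λ i j i<j mt → proj₂ (proj₂ (side i)) (meets-mono
              (proj₂ (⊑-trans (proj₁ (proj₂ (side j))) (state-mono j i<j))) id mt)
          }

    -- The upper bound Π⁰₃

    mixed-open : ∀ V → IsOpen (𝒫 (Carrier X)) (λ χ → Mixed V (T ∘ χ))
    mixed-open V χ ((x , xv , xa) , (y , yv , yb)) = x ∷ y ∷ [] , λ where
      ψ (e ∷ e′ ∷ []) → (x , xv , subst T (sym e) xa) , (y , yv , yb ∘ subst T e′)

    unmixed-closed : ∀ V → IsOpen (𝒫 (Carrier X)) (∁ λ χ → ¬ Mixed V (T ∘ χ))
    unmixed-closed V = Space.open-≐ (𝒫 (Carrier X)) ((λ m h → h m) , by-contradiction) (mixed-open V)

    -- `LocallyPure` reads `∀ n ∃ m` over a condition closed in `χ`. The `Lift`s place the members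
    -- of the unions in the universe of `𝓜 X`.
    𝓜-Π⁰₃ : Π⁰ (𝒫 (Carrier X)) 3 (𝓜 X)
    𝓜-Π⁰₃ = isUnion (s≤s (s≤s z≤n))
      (λ n χ → Lift _ (Satisfiable (B n) × ¬ (∃[ m ] Below n m χ)))
      (λ n → 2 , ℕ.≤-refl , complement n)
      ((λ ¬mon →
          let n , h = ¬∀⇒∃¬ (¬mon ∘ pure⇒monitorable)
              ne , h′ = ¬∀⇒∃¬ h
          in n , lift (ne , h′)) ,
       λ (n , lift (ne , h)) mon → h (monitorable⇒pure mon n ne))
      where
      Below : ℕ → ℕ → Pred (Carrier X → Bool) 0ℓ
      Below n m χ = m ⊑ n × ¬ Mixed (B m) (T ∘ χ)
      complement : ∀ n → Σ⁰ (𝒫 (Carrier X)) 2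
        (∁ λ χ → Lift (lsuc 0ℓ) (Satisfiable (B n) × ¬ (∃[ m ] Below n m χ)))
      complement n = isUnion ℕ.≤-refl
        (λ m χ → Lift _ (Satisfiable (B n) → Below n m χ))
        (λ m → 1 , ℕ.≤-refl , isOpen _
          (closed-∀ (𝒫 (Carrier X)) (λ (_ : Satisfiable (B n)) → Below n m) λ _ →
            closed-guard (𝒫 (Carrier X)) λ _ → unmixed-closed (B m))
          ((λ h g → h (lift g)) , λ h (lift g) → h g))
        (fwd , λ (m , lift h) (lift (ne , none)) → none (m , h ne))
        where
        fwd : ∀ {χ} → ¬ Lift (lsuc 0ℓ) (Satisfiable (B n) × ¬ (∃[ m ] Below n m χ)) →
          ∃[ m ] Lift (lsuc 0ℓ) (Satisfiable (B n) → Below n m χ)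
        fwd {χ} h with em _ {Satisfiable (B n)}
        -- For an empty `B n` every index serves; 0 is arbitrary.
        ... | no empty = 0 , lift λ ne → contradiction ne empty
        ... | yes ne =
          let m , b = by-contradiction {P = ∃[ m ] Below n m χ} λ none → h (lift (ne , none))
          in m , lift λ _ → b

    -- Σ⁰₂ in the absence of an antichain

    record FiniteCore : Set where
      field
        core           : List ℕ
        hyperconnected : ∀ h → h ∈ˡ core → Hyperconnected h
        inhabited      : ∀ h → h ∈ˡ core → Satisfiable (B h)
        predense       : ∀ n → Satisfiable (B n) → Rich n → ∃[ h ] h ∈ˡ core × Meets n h

    -- If no finite list of hyperconnected rich sets is a core, each list misses some rich set. That
    -- set contains a hyperconnected one, which extends the list; the resulting sequence is an
    -- antichain.
    finite-core : ¬ Antichain → FiniteCore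
    finite-core none = by-contradiction λ ¬core →
      let s , good , _ , apart = greedy {P = λ _ _ → ⊤} {R = λ m n → ¬ Meets m n} (pick ¬core)
      in none record
        { member = s ; inhabited = λ i → proj₁ (good i)
        ; rich = λ i → proj₁ (proj₂ (good i)) ; disjoint = apart }
      where
      Good : Pred ℕ 0ℓ
      Good n = Satisfiable (B n) × Rich n × Hyperconnected n
      pick : ¬ FiniteCore → ∀ (j : ℕ) L → All Good L →
        ∃[ n ] Good n × ⊤ × All (λ m → ¬ Meets n m) L
      pick ¬core _ L good = by-contradiction λ stuck → ¬core record
        { core = L
        ; hyperconnected = λ h h∈ → proj₂ (proj₂ (All.lookup good h∈))
        ; inhabited = λ h h∈ → proj₁ (All.lookup good h∈)
        ; predense = λ n ne rich → by-contradiction λ free →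
            let h , h⊑n , hyper = hyperconnected-below none ne rich
            in stuck (h , (proj₁ h⊑n , rich-mono h⊑n rich , hyper) , _ ,
                 All.tabulate λ m∈ mt → free (_ , m∈ , meets-mono (proj₂ h⊑n) id mt))
        }

    -- As the core is finite, a single `N` bounds the indices of the unmixed sets for all its
    -- members. For fixed `N`, each clause is closed: one unmixedness condition for an atom, a
    -- finite union of such for a member of the core.
    core⇒Σ⁰₂ : FiniteCore → Σ⁰ (𝒫 (Carrier X)) 2 (𝓜 X)
    core⇒Σ⁰₂ c = isUnion ℕ.≤-refl (λ N χ → Lift _ (∀ t → Clause N t χ))
      (λ N → 1 , ℕ.≤-refl , isOpen _ (closed-∀ (𝒫 (Carrier X)) (Clause N) (clause-closed N))
        ((λ h g → h (lift g)) , λ h (lift g) → h g))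
      ((λ mon → let N , b = pure⇒bounded (monitorable⇒pure mon) in N , lift b) ,
       λ (N , lift b) → pure⇒monitorable (bounded⇒pure b))
      where
      open FiniteCore c
      Clause : ℕ → ∃ Atomic ⊎ (∃[ h ] h ∈ˡ core) → Pred (Carrier X → Bool) 0ℓ
      Clause N (inj₁ (k , _)) χ = ¬ Mixed (B k) (T ∘ χ)
      Clause N (inj₂ (h , _)) χ = ∃[ m ] m < N × m ⊑ h × ¬ Mixed (B m) (T ∘ χ)
      clause-closed : ∀ N t → IsOpen (𝒫 (Carrier X)) (∁ (Clause N t))
      clause-closed N (inj₁ (k , _)) = unmixed-closed (B k)
      clause-closed N (inj₂ (h , _)) =
        closed-∃< (𝒫 (Carrier X)) (λ m χ → m ⊑ h × ¬ Mixed (B m) (T ∘ χ))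
          (λ m → closed-guard (𝒫 (Carrier X)) λ _ → unmixed-closed (B m)) N
      pure⇒bounded : ∀ {χ} → LocallyPure (T ∘ χ) → ∃[ N ] (∀ t → Clause N t χ)
      pure⇒bounded pure =
        let N , b = common-bound core λ h h∈ → pure h (inhabited h h∈)
        in N , λ where
          -- An unmixed set below an atom contains the whole atom.
          (inj₁ (k , ne , minimal)) mixed →
            let m , m⊑k , ¬mixed = pure k ne in ¬mixed (mixed-mono (minimal m m⊑k) mixed)
          (inj₂ (h , h∈)) → b h h∈
      bounded⇒pure : ∀ {N χ} → (∀ t → Clause N t χ) → LocallyPure (T ∘ χ)
      bounded⇒pure b n ne with em _ {Rich n}
      ... | no ¬rich = let k , k⊑n , atom = ¬rich⇒atom ¬rich in k , k⊑n , b (inj₁ (k , atom))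
      ... | yes rich =
        -- By hyperconnectedness of `h`, the part of `B n` inside `B h` meets the unmixed `B m`, and
        -- a common subset is unmixed.
        let h , h∈ , mt = predense n ne rich
            i , i⊑n , i⊑h = meet mt
            m , _ , m⊑h , ¬mixed = b (inj₂ (h , h∈))
            k , k⊑i , k⊑m = meet (hyperconnected h h∈ i m i⊑h m⊑h)
        in k , ⊑-trans k⊑i i⊑n , ¬mixed ∘ mixed-mono (proj₂ k⊑m)

    -- The reduction from Π⁰₃ sets

    module Reduction (antichain : Antichain) (Y : Space)
      (K : ℕ → ℕ → ℕ → Pred (Carrier Y) 0ℓ) (K-clopen : ∀ n m k → Clopen Y (K n m k)) where
      open Antichain antichain renaming (member to S)

      meets⇒same : ∀ i j → Meets (S i) (S j) → i ≡ j
      meets⇒same i j mt with ℕ.<-cmp i j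
      ... | tri< i<j _ _ = contradiction (meets-sym mt) (disjoint i j i<j)
      ... | tri≈ _ i≡j _ = i≡j
      ... | tri> _ _ j<i = contradiction mt (disjoint j i j<i)

      abstract
        -- The default `S n` gives every triple a place for its point; only the `m` below `S n`
        -- matter for mixing.
        target : ∀ n m → ∃[ i ] i ⊑ S n × (m ⊑ S n → i ≡ m)
        target n m with em _ {m ⊑ S n}
        ... | yes m⊑ = m , m⊑ , λ _ → refl
        ... | no ¬m⊑ = S n , ⊑-refl (inhabited n) , λ m⊑ → contradiction m⊑ ¬m⊑

      Target : ℕ → Pred (Carrier X) 0ℓ
      Target j = let n , m , _ = decode triples j in B (proj₁ (target n m))

      -- Inside the target, shrink to a set missing all earlier points, which are negligible, and
      -- use richness of `S n` for a new one.
      points : Σ[ p ∈ (ℕ → Carrier X) ] (∀ j → Negligible (p j)) × (∀ j → p j ∈ Target j) ×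
        (∀ i j → i < j → p j ≢ p i)
      points = greedy {P = λ j x → x ∈ Target j} {R = _≢_} λ j L negl →
        let n , m , _ = decode triples j
            t , t⊑S , _ = target n m
            t′ , t′⊑t , L∉ = avoid L negl t (proj₁ t⊑S)
            q , q∈ , negl-q = rich n t′ (⊑-trans t′⊑t t⊑S)
        in q , negl-q , proj₂ t′⊑t q∈ , All.map (λ x∉ q≡x → x∉ (subst (B t′) q≡x q∈)) L∉

      p : ℕ → Carrier X
      p = proj₁ points

      p-injective : ∀ i j → p i ≡ p j → i ≡ j
      p-injective i j e with ℕ.<-cmp i j
      ... | tri< i<j _ _ = contradiction (sym e) (proj₂ (proj₂ (proj₂ points)) i j i<j)
      ... | tri≈ _ i≡j _ = i≡j
      ... | tri> _ _ j<i = contradiction e (proj₂ (proj₂ (proj₂ points)) j i j<i)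

      pt : ℕ × ℕ × ℕ → Carrier X
      pt = p ∘ encode triples

      pt-injective : ∀ {t u} → pt t ≡ pt u → t ≡ u
      pt-injective {t} {u} e = trans (sym (decode-encode triples t))
        (trans (cong (decode triples) (p-injective (encode triples t) (encode triples u) e))
          (decode-encode triples u))

      pt∈target : ∀ n m k → pt (n , m , k) ∈ B (proj₁ (target n m))
      pt∈target n m k = subst (λ (n′ , m′ , _) → pt (n , m , k) ∈ B (proj₁ (target n′ m′)))
        (decode-encode triples (n , m , k)) (proj₁ (proj₂ (proj₂ points)) (encode triples (n , m , k)))

      pt∈ : ∀ n m k → m ⊑ S n → pt (n , m , k) ∈ B m
      pt∈ n m k m⊑ =
        subst (λ i → pt (n , m , k) ∈ B i) (proj₂ (proj₂ (target n m)) m⊑) (pt∈target n m k)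

      pt∈S : ∀ n m k → pt (n , m , k) ∈ B (S n)
      pt∈S n m k = proj₂ (proj₁ (proj₂ (target n m))) (pt∈target n m k)

      -- Bounding the witnesses by `k` keeps the condition clopen and makes a first stage
      -- meaningful. A row with witnesses for all clauses refutes membership in the Π⁰₃ set.
      Refuted : ℕ → ℕ → ℕ → Pred (Carrier Y) 0ℓ
      Refuted n m k y = ∀ i → i < m → ∃[ j ] j < k × K n i j y

      Fires : ℕ × ℕ × ℕ → Pred (Carrier Y) 0ℓ
      Fires (n , m , k) y = Refuted n m k y × (∀ j → j < k → ¬ Refuted n m j y)

      fires-unique : ∀ {n m k k′ y} → Fires (n , m , k) y → Fires (n , m , k′) y → k ≡ k′
      fires-unique {k = k} {k′} (r , least) (r′ , least′) with ℕ.<-cmp k k′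
      ... | tri< k<k′ _ _ = contradiction r (least′ k k<k′)
      ... | tri≈ _ k≡k′ _ = k≡k′
      ... | tri> _ _ k′<k = contradiction r′ (least k′ k′<k)

      fires-clopen : ∀ x → Clopen Y (Fires x)
      fires-clopen (n , m , k) = clopen-∩ Y (refuted-clopen k)
        (clopen-∀< Y _ (λ j → clopen-∁ Y (refuted-clopen j)) k)
        where
        refuted-clopen : ∀ k → Clopen Y (Refuted n m k)
        refuted-clopen k = clopen-∀< Y _ (λ i → clopen-∃< Y _ (K-clopen n i) k) m

      refuted⇒fires : ∀ {n y} → (∀ m → ∃[ k ] K n m k y) → ∀ m → ∃[ k ] Fires (n , m , k) y
      refuted⇒fires h m =
        let k , b = common-bound (upTo m) λ i _ → h i
        in least (k , λ i i<m → b i (∈-upTo⁺ i<m))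

      Selected : Carrier Y → Pred (Carrier X) 0ℓ
      Selected y x = ∃[ t ] pt t ≡ x × Fires t y

      abstract
        f : Carrier Y → Carrier X → Bool
        f y x = ⌊ em _ {Selected y x} ⌋

        selected : ∀ {y x} → T (f y x) ⇔ Selected y x
        selected = mk⇔ toWitness fromWitness

      -- Since `pt` is injective, selection of a point depends on one clopen condition `Fires t`, or
      -- never happens.
      f-continuous : Continuous Y (𝒫 (Carrier X)) f
      f-continuous = continuous-into-𝒫 Y f λ x → clopen-≐ Y (from selected , to selected) (clopen x)
        where
        clopen : ∀ x → Clopen Y (λ y → Selected y x)
        clopen x with em _ {∃[ t ] pt t ≡ x}
        ... | no none = clopen-≐ Y ((λ ()) , λ (t , e , _) → none (t , e)) (clopen-∅ Y)
        ... | yes (t , e) = clopen-≐ Y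
          ((λ fires → t , e , fires) ,
           λ (u , e′ , fires) → subst (λ t → Fires t _) (pt-injective (trans e′ (sym e))) fires)
          (fires-clopen t)

      -- Were row `n` complete, any `r` below `S n` would be mixed: the point at the firing stage
      -- `k` is selected, and the one at `suc k` is not, as the firing stage is unique.
      monitorable⇒ : ∀ y → 𝓜 X (f y) → y ∉ ∃∀∃ K
      monitorable⇒ y mon (n , h)
        with r , r⊑S , ¬mixed ← monitorable⇒pure mon (S n) (inhabited n)
        with k , fires ← refuted⇒fires h r
        = ¬mixed ((_ , pt∈ n r k r⊑S , from selected (_ , refl , fires)) ,
                  (_ , pt∈ n r (suc k) r⊑S , unselected ∘ to selected))
        where
        unselected : ¬ Selected y (pt (n , r , suc k))
        unselected (t , e , fires′) = ℕ.1+n≢n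
          (fires-unique (subst (λ t → Fires t y) (pt-injective e) fires′) fires)

      -- A clause without witness stops all later firing in row `n`, and each remaining `m` selects
      -- at most one point. Points of other rows lie in other members of the antichain.
      finitely-selected : ∀ y → y ∉ ∃∀∃ K → ∀ n →
        Σ[ L ∈ List (Carrier X) ] All Negligible L × (∀ x → x ∈ B (S n) → Selected y x → x ∈ˡ L)
      finitely-selected y h n =
        map at (upTo (suc bound)) ,
        All.map⁺ (All.universal
          (λ m → proj₁ (proj₂ points) (encode triples (n , m , stage m (em _)))) _) ,
        complete
        where
        last : ∃[ m ] ¬ (∃[ k ] K n m k y)
        last = ¬∀⇒∃¬ λ g → h (n , g)
        bound = proj₁ last
        stage : ∀ m → Dec (∃[ k ] Fires (n , m , k) y) → ℕ
        stage m (yes (k , _)) = k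
        -- The default only adds a harmless negligible point to the list.
        stage m (no _) = 0
        stage-fires : ∀ m k d → Fires (n , m , k) y → stage m d ≡ k
        stage-fires m k (yes (_ , fires′)) fires = fires-unique fires′ fires
        stage-fires m k (no none) fires = contradiction (k , fires) none
        at : ℕ → Carrier X
        at m = pt (n , m , stage m (em _))
        complete : ∀ x → x ∈ B (S n) → Selected y x → x ∈ˡ map at (upTo (suc bound))
        complete x x∈S ((n′ , m , k) , refl , fires)
          with refl ← meets⇒same n′ n (x , pt∈S n′ m k , x∈S)
          = subst (_∈ˡ map at (upTo (suc bound)))
              (cong (λ k → pt (n , m , k)) (stage-fires m k (em _) fires))
              -- `Fires` at `m` concerns the clauses below `m`, so it can still happen for `m` equal
              -- to `bound`, hence `upTo (suc bound)`.
              (∈-map⁺ at (∈-upTo⁺ (s≤s (ℕ.≮⇒≥ λ b<m →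
                let j , _ , kj = proj₁ fires bound b<m in proj₂ last (j , kj)))))

      -- A basic set missing every `S n` has no selected point; one that meets `S n` has a subset
      -- inside `S n` avoiding the finitely many selected points there.
      ⇒monitorable : ∀ y → y ∉ ∃∀∃ K → 𝓜 X (f y)
      ⇒monitorable y h = pure⇒monitorable pure
        where
        pure : LocallyPure (T ∘ f y)
        pure i ne with em _ {∃[ n ] Meets i (S n)}
        ... | no none = i , ⊑-refl ne , λ ((x , xi , t) , _) → unselected x xi (to selected t)
          where
          unselected : ∀ x → x ∈ B i → ¬ Selected y x
          unselected x xi ((n , m , k) , refl , _) = none (n , x , xi , pt∈S n m k)
        ... | yes (n , mt) =
          let i′ , i′⊑i , i′⊑S = meet mt
              L , negligible , complete = finitely-selected y h n
              r , r⊑i′ , L∉ = avoid L negligible i′ (proj₁ i′⊑i)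
          in r , ⊑-trans r⊑i′ i′⊑i , λ ((x , xr , t) , _) →
               All.lookup L∉ (complete x (proj₂ i′⊑S (proj₂ r⊑i′ xr)) (to selected t)) xr

    -- Hardness and the diagonal argument

    antichain⇒hard : Antichain → Hard (λ Z → Π⁰ Z 3) (𝒫 (Carrier X)) (𝓜 X)
    antichain⇒hard antichain Y polish zd A π =
      let K , clopen , nf = Σ⁰₃-normal-form Y (polish-covers Y polish zd) π
          open Reduction antichain Y K clopen
      in f , f-continuous ,
         ((λ {y} a → ⇒monitorable y λ e → from (nf y) e a) ,
          (λ {y} mon → by-contradiction λ na → monitorable⇒ y mon (to (nf y) na)))

    -- A point of Cantor space codes a family of open sets O n m, where O n m is the
    -- union of the cylinders it lists; the diagonal set escapes every ⋃ₙ ⋂ₘ O n m.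
    antichain⇒¬Σ⁰₃ : Antichain → ¬ Σ⁰ (𝒫 (Carrier X)) 3 (𝓜 X)
    antichain⇒¬Σ⁰₃ antichain σ = ¬coded (K⇒coded (to (nf-⇔ χ) (⇒monitorable χ ¬coded)))
      where
      Coded : ℕ → ℕ → ℕ → Pred (ℕ → Bool) 0ℓ
      Coded n m k χ = T (χ (encode triples (n , m , k))) × Cylinder (decode cylinders k) χ
      Coded-clopen : ∀ n m k → Clopen (𝒫 ℕ) (Coded n m k)
      Coded-clopen n m k = clopen-∩ (𝒫 ℕ)
        (coordinate-open (encode triples (n , m , k)) T ,
         coordinate-open (encode triples (n , m , k)) (∁ T))
        (Cylinder-clopen (decode cylinders k))
      open Reduction antichain (𝒫 ℕ) Coded Coded-clopen

      nf : Σ[ K ∈ (ℕ → ℕ → ℕ → Pred (ℕ → Bool) 0ℓ) ] (∀ n m k → Clopen (𝒫 ℕ) (K n m k)) ×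
        (∀ χ → 𝓜 X (f χ) ⇔ χ ∈ ∃∀∃ K)
      nf = Σ⁰₃-normal-form (𝒫 ℕ) cantor-covers (preimage-Σ⁰ f-continuous σ)
      K = proj₁ nf
      nf-⇔ = proj₂ (proj₂ nf)

      O : ℕ → ℕ → Pred (ℕ → Bool) 0ℓ
      O n m = ⋃ ℕ (K n m)
      O-covers : ∀ n m → Σ[ C ∈ (ℕ → Pred (ℕ → Bool) 0ℓ) ] (∀ k → Clopen (𝒫 ℕ) (C k)) × O n m ≐ ⋃ ℕ C
      O-covers n m = cantor-covers (O n m)
        (Space.open-⋃ (𝒫 ℕ) (K n m) λ l → proj₁ (proj₁ (proj₂ nf) n m l))
      Listed : ℕ × ℕ × ℕ → Set
      Listed (n , m , k) = ∀ χ → χ ∈ Cylinder (decode cylinders k) → χ ∈ O n m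
      -- Listing every cylinder inside `O n m` makes `χ` code the family `O` itself. At `χ`, then,
      -- `∃∀∃ K` and `∃∀∃ Coded` agree, whereas the reduction makes them complementary.
      χ : ℕ → Bool
      χ j = ⌊ em _ {Listed (decode triples j)} ⌋
      listed : ∀ t → T (χ (encode triples t)) ⇔ Listed t
      listed t = mk⇔ (λ h → subst Listed (decode-encode triples t) (toWitness h))
        (λ l → fromWitness (subst Listed (sym (decode-encode triples t)) l))

      K⇒coded : χ ∈ ∃∀∃ K → χ ∈ ∃∀∃ Coded
      K⇒coded (n , h) = n , λ m →
        -- The cover given by `cantor-covers` supplies the code `k` of a cylinder around `χ` inside
        -- `O n m`.
        let k , C⊆O , c = proj₁ (proj₂ (proj₂ (O-covers n m))) (h m)
        in k , from (listed (n , m , k)) (λ _ → C⊆O) , c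
      coded⇒K : χ ∈ ∃∀∃ Coded → χ ∈ ∃∀∃ K
      coded⇒K (n , h) = n , λ m → let k , t , c = h m in to (listed (n , m , k)) t χ c
      ¬coded : χ ∉ ∃∀∃ Coded
      ¬coded coded = monitorable⇒ χ (from (nf-⇔ χ) (coded⇒K coded)) coded

corollary3p14 : (∀ ℓ → ExcludedMiddle ℓ) →
    (∀ a b → Extensionality a b) →
    (X : Space) → Countable (Carrier X) → SecondCountable X →
    (¬ Σ⁰ (𝒫 (Carrier X)) 2 (𝓜 X) →
    CompleteFor (λ Z → Π⁰ Z 3) (𝒫 (Carrier X)) (𝓜 X))
    × ¬ Δ⁰-Sharp (𝒫 (Carrier X)) 3 (𝓜 X)
corollary3p14 em _ X _ secondCountable =
  (λ ¬Σ⁰₂ → 𝓜-Π⁰₃ , antichain⇒hard (antichain ¬Σ⁰₂)) ,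
  -- Sharpness denies Σ⁰₂, which gives an antichain, and this contradicts the Σ⁰₃ half of Δ⁰₃.
  λ ((σ , _) , sharp) →
    antichain⇒¬Σ⁰₃ (antichain λ σ₂ → sharp (2 , ℕ.≤-refl , inj₁ σ₂)) σ
  where
  open Classical em
  open Monitorability X secondCountable
  antichain : ¬ Σ⁰ (𝒫 (Carrier X)) 2 (𝓜 X) → Antichain
  antichain ¬Σ⁰₂ = by-contradiction λ none → ¬Σ⁰₂ (core⇒Σ⁰₂ (finite-core none))
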